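{- The first moment of the one-parameter family $E: y^2=4x^3+(4m+1)x^2+n\cdot t x$ (with parameter $t$ and integers $m,n$) is $0$, that is, $A_{1,E}(p)=0$.
   Context: Here $p$ is an odd prime and $\left(\frac{\cdot}{p}\right)$ denotes the Legendre symbol, with $\left(\frac{u}{p}\right)=0$ if $p\mid u$. For a family $y^2=f_t(x)$, with $f_t(x)$ a cubic polynomial in $x$ whose coefficients are integer polynomials in $t$, one sets $a_t(p):=p-\#\{(x,y)\in(\mathbb{Z}/p\mathbb{Z})^2: y^2\equiv f_t(x) \bmod p\}=-\sum_{x \bmod p}\left(\frac{f_t(x)}{p}\right)$. The first moment of the family is $A_{1,E}(p):=\frac1p\sum_{t \bmod p}a_t(p)$, the sum running over all residues $t$ modulo $p$.
   Formalization: The hypothesis that p does not divide n is added: if p | n, then a_t(p) = ((4m+1)/p) for every t, so the claim fails, e.g. for p = 3, m = 0, n = 3, where the first moment is 1. -}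

module Defs where

open import Data.Fin.Base using (Fin; toℕ)
open import Data.Integer.Base using (ℤ; +_; _+_; _*_; _-_; _^_)
open import Data.Integer.Divisibility.Signed using (_∣_; _∣?_)
open import Data.Integer.Properties using (+-0-commutativeMonoid)
open import Data.List.Base using (List; length; filter; allFin; cartesianProduct)
open import Data.Nat.Base using (ℕ; NonZero)
open import Data.Product.Base using (_×_; _,_)
open import Data.Rational.Base using (ℚ; _/_)
open import Relation.Nullary using (Dec)

open import Algebra.Properties.CommutativeMonoid.Sum +-0-commutativeMonoid
  using (sum-syntax)

-- Residues modulo p are represented by 0, …, p - 1.
residue : {p : ℕ} → Fin p → ℤ
residue i = + toℕ i

infix 4 _≡_mod_

_≡_mod_ : ℤ → ℤ → ℕ → Set
a ≡ b mod p = + p ∣ a - b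

-- A family y² = f t x.  The quantities below are independent of the choice of
-- representatives of the residues whenever f is a polynomial in t and x.
Family : Set
Family = ℤ → ℤ → ℤ

OnCurve : Family → (p : ℕ) → ℤ → Fin p × Fin p → Set
OnCurve f p t (x , y) = residue y ^ 2 ≡ f t (residue x) mod p

onCurve? : (f : Family) (p : ℕ) (t : ℤ) (xy : Fin p × Fin p) →
           Dec (OnCurve f p t xy)
onCurve? f p t (x , y) = + p ∣? (residue y ^ 2 - f t (residue x))

#points : Family → ℕ → ℤ → ℕ
#points f p t =
  length (filter (onCurve? f p t) (cartesianProduct (allFin p) (allFin p)))

a : Family → ℤ → ℕ → ℤ
a f t p = + p - + #points f p t

A₁ : Family → (p : ℕ) → .{{NonZero p}} → ℚ
A₁ f p = (∑[ t < p ] a f (residue t) p) / p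

E : ℤ → ℤ → Family
E m n t x = + 4 * x ^ 3 + (+ 4 * m + + 1) * x ^ 2 + n * t * x

{-# OPTIONS --safe #-}

-- The affine points over all fibres are counted by summing over x first.  If
-- x ≢ 0 mod p, the equation is linear in t with invertible leading coefficient
-- n x, so each y belongs to exactly one t; if x ≡ 0, it reads y² ≡ 0, so each t
-- admits only y ≡ 0.  Every x thus contributes p points, and the resulting
-- total p² is the sum of the main terms p over the p values of t.

module Submission where

open import Defs
open import Data.Nat.Base using (ℕ; NonZero)
open import Data.Nat.Primality using (Prime)
open import Data.Integer.Base using (ℤ; +_)
open import Data.Integer.Divisibility.Signed using (_∣_)
open import Data.Rational.Base using (0ℚ)
open import Relation.Binary.PropositionalEquality using (_≡_; _≢_)
open import Relation.Nullary using (¬_)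

open import Data.Bool.Base using (true; false; if_then_else_)
open import Data.Fin.Base using (Fin; zero; suc; toℕ; fromℕ<)
open import Data.Fin.Properties using (toℕ-injective; toℕ-fromℕ<; toℕ<n; suc-injective)
open import Data.Integer.Base using (0ℤ; 1ℤ; _+_; _*_; _-_; -_; _^_)
import Data.Integer.Base as ℤ
open import Data.Integer.DivMod using (_%ℕ_; _/ℕ_; n%ℕd<d; a≡a%ℕn+[a/ℕn]*n)
open import Data.Integer.Divisibility.Signed
  using (_∣?_; divides; ∣ᵤ⇒∣; ∣⇒∣ᵤ; ∣m∣n⇒∣m+n; ∣m∣n⇒∣m-n; ∣n⇒∣m*n; ∣m⇒∣m*n)
open import Data.Integer.Properties
  using (+-0-commutativeMonoid; pos-*; abs-*; +-injective; ∣i∣≡0⇒i≡0; i-j≡0⇒i≡j;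
         [+m]-[+n]≡m⊖n; *-identityʳ; +-identityˡ; ∣m⊝n∣≤m⊔n; +-inverseʳ)
open import Data.Integer.Tactic.RingSolver using (solve-∀)
open import Data.List.Base using (_∷_; _++_; length; filter; map; tabulate; cartesianProduct)
open import Data.List.Properties using (filter-++; length-++; map-tabulate)
import Data.Nat.Base as ℕ
import Data.Nat.Divisibility as ℕ
import Data.Nat.Properties as ℕ
open import Data.Nat.Coprimality using (coprime-Bézout; prime⇒coprime)
open import Data.Nat.GCD using (module Bézout)
open import Data.Nat.Primality using (euclidsLemma)
open import Data.Product using (∃; ∃!; _×_; _,_)
open import Data.Rational.Base using (_/_)
open import Data.Rational.Properties using (0/n≡0)
open import Data.Sum.Base as Sum using (_⊎_; [_,_]′)
open import Function.Base using (_∘_; id)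
open import Relation.Binary.PropositionalEquality
  using (refl; sym; trans; cong; cong₂; subst; module ≡-Reasoning)
open import Relation.Nullary using (Dec; yes; no; does; contradiction)
open import Relation.Unary using (Decidable)

open import Algebra.Properties.CommutativeMonoid.Sum +-0-commutativeMonoid
  using (sum-syntax; sum-cong-≗; sum-replicate-zero; ∑-comm; ∑-distrib-+)

-- Finite integer sums and indicators.

𝟙 : ∀ {P : Set} → Dec P → ℤ
𝟙 P? = if does P? then 1ℤ else 0ℤ

∑-const : ∀ n c → ∑[ i < n ] c ≡ + n * c
∑-const ℕ.zero    c = refl
∑-const (ℕ.suc n) c = trans (cong (λ s → c + s) (∑-const n c)) (step (+ n) c)
  where
  step : ∀ n c → c + n * c ≡ (1ℤ + n) * c
  step = solve-∀

i-j+j≡i : ∀ i j → i - j + j ≡ i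
i-j+j≡i = solve-∀

i+j-j≡i : ∀ i j → i + j - j ≡ i
i+j-j≡i = solve-∀

∑-minus : ∀ n c (f : Fin n → ℤ) → ∑[ i < n ] (c - f i) ≡ + n * c - ∑[ i < n ] f i
∑-minus n c f = begin
  -- Adding and subtracting `∑f` reduces the claim to additivity of sums: the terms `c - f i + f i`
  -- collapse to `c`.
  ∑[ i < n ] (c - f i)                  ≡⟨ i+j-j≡i _ ∑f ⟨
  ∑[ i < n ] (c - f i) + ∑f - ∑f        ≡⟨ cong (_- ∑f) (∑-distrib-+ (λ i → c - f i) f) ⟨
  ∑[ i < n ] (c - f i + f i) - ∑f       ≡⟨ cong (_- ∑f) (sum-cong-≗ (λ i → i-j+j≡i c (f i))) ⟩
  ∑[ i < n ] c - ∑f                     ≡⟨ cong (_- ∑f) (∑-const n c) ⟩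
  + n * c - ∑f                          ∎
  where
  open ≡-Reasoning
  ∑f = ∑[ i < n ] f i

∑-ones : ∀ {n} {f : Fin n → ℤ} → (∀ i → f i ≡ 1ℤ) → ∑[ i < n ] f i ≡ + n
∑-ones {n} f≡1 = trans (sum-cong-≗ f≡1) (trans (∑-const n 1ℤ) (*-identityʳ (+ n)))

𝟙-yes : ∀ {P : Set} (P? : Dec P) → P → 𝟙 P? ≡ 1ℤ
𝟙-yes (yes _) _ = refl
𝟙-yes (no ¬p) p = contradiction p ¬p

𝟙-no : ∀ {P : Set} (P? : Dec P) → ¬ P → 𝟙 P? ≡ 0ℤ
𝟙-no (yes p) ¬p = contradiction p ¬p
𝟙-no (no _)  _  = refl

-- Induction on the position of the witness: at the head, uniqueness makes all later indicators
-- vanish; further on, it kills the head and passes to the tail.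
∑-𝟙-unique : ∀ {n} {P : Fin n → Set} (P? : Decidable P) →
             ∃! _≡_ P → ∑[ i < n ] 𝟙 (P? i) ≡ 1ℤ
∑-𝟙-unique {ℕ.suc n} P? (zero , p , unique) =
  cong₂ _+_ (𝟙-yes (P? zero) p)
    (trans (sum-cong-≗ (λ i → 𝟙-no (P? (suc i)) (λ q → contradiction (unique q) λ ())))
           (sum-replicate-zero n))
∑-𝟙-unique {ℕ.suc n} P? (suc i , p , unique) =
  cong₂ _+_ (𝟙-no (P? zero) (λ q → contradiction (unique q) λ ()))
    (∑-𝟙-unique (λ j → P? (suc j)) (i , p , λ q → suc-injective (unique q)))

∃!-map : ∀ {A : Set} {P Q : A → Set} → (∀ {x} → P x → Q x) → (∀ {x} → Q x → P x) →
         ∃! _≡_ P → ∃! _≡_ Q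
∃!-map P⇒Q Q⇒P (x , p , unique) = x , P⇒Q p , λ q → unique (Q⇒P q)

-- Counting list elements by sums of indicators.

length-filter-∷ : ∀ {A : Set} {P : A → Set} (P? : Decidable P) x xs →
                  + length (filter P? (x ∷ xs)) ≡ 𝟙 (P? x) + + length (filter P? xs)
-- `filter` and `𝟙` both branch on this Boolean alone, so splitting on it reduces both sides.
length-filter-∷ P? x xs with does (P? x)
... | true  = refl
... | false = sym (+-identityˡ _)

-- Stated for any `f`, since removing the head of the list replaces `f` by `f ∘ suc`; `allFin` is
-- the case `f = id`.
length-filter-tabulate : ∀ {A : Set} {P : A → Set} (P? : Decidable P) {n} (f : Fin n → A) →
                         + length (filter P? (tabulate f)) ≡ ∑[ i < n ] 𝟙 (P? (f i))
length-filter-tabulate P? {ℕ.zero}  f = refl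
length-filter-tabulate P? {ℕ.suc n} f =
  trans (length-filter-∷ P? (f zero) (tabulate (f ∘ suc)))
        (cong (λ s → 𝟙 (P? (f zero)) + s) (length-filter-tabulate P? (f ∘ suc)))

length-filter-cartesianProduct :
  ∀ {A B : Set} {P : A × B → Set} (P? : Decidable P) {m n} (f : Fin m → A) (g : Fin n → B) →
  + length (filter P? (cartesianProduct (tabulate f) (tabulate g))) ≡
  ∑[ i < m ] ∑[ j < n ] 𝟙 (P? (f i , g j))
length-filter-cartesianProduct P? {ℕ.zero}  f g = refl
length-filter-cartesianProduct P? {ℕ.suc m} {n} f g = begin
  + length (filter P? (row ++ rest))
    ≡⟨ cong (λ l → + length l) (filter-++ P? row rest) ⟩
  + length (filter P? row ++ filter P? rest)
    ≡⟨ cong +_ (length-++ (filter P? row)) ⟩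
  + length (filter P? row) + + length (filter P? rest)
    ≡⟨ cong₂ _+_
         (trans (cong (λ l → + length (filter P? l)) (map-tabulate g (f zero ,_)))
                (length-filter-tabulate P? (λ j → f zero , g j)))
         (length-filter-cartesianProduct P? (f ∘ suc) g) ⟩
  ∑[ i < ℕ.suc m ] ∑[ j < n ] 𝟙 (P? (f i , g j)) ∎
  where
  open ≡-Reasoning
  row  = map (f zero ,_) (tabulate g)
  rest = cartesianProduct (tabulate (f ∘ suc)) (tabulate g)

#points-∑ : ∀ f p t → + #points f p t ≡ ∑[ x < p ] ∑[ y < p ] 𝟙 (onCurve? f p t (x , y))
#points-∑ f p t = length-filter-cartesianProduct (onCurve? f p t) id id

-- Residues and linear congruences modulo a prime.

residue-injective : ∀ {p} {i j : Fin p} → + p ∣ residue i - residue j → i ≡ j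
residue-injective {p} {i} {j} p∣i-j =
  -- The difference is a multiple of `p` whose absolute value is at most the larger representative,
  -- hence below `p`; so it is 0.
  toℕ-injective (+-injective (i-j≡0⇒i≡j (residue i) (residue j)
    (∣i∣≡0⇒i≡0 (multiple<p (∣⇒∣ᵤ p∣i-j) d<p))))
  where
  multiple<p : ∀ {d} → p ℕ.∣ d → d ℕ.< p → d ≡ 0
  multiple<p {ℕ.zero}  _   _   = refl
  multiple<p {ℕ.suc _} p∣d d<p = contradiction p∣d (ℕ.>⇒∤ d<p)

  d<p : ℤ.∣ residue i - residue j ∣ ℕ.< p
  d<p = ℕ.≤-<-trans
    (subst (λ d → ℤ.∣ d ∣ ℕ.≤ toℕ i ℕ.⊔ toℕ j) (sym ([+m]-[+n]≡m⊖n (toℕ i) (toℕ j)))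
      (∣m⊝n∣≤m⊔n (toℕ i) (toℕ j)))
    (ℕ.⊔-lub (toℕ<n i) (toℕ<n j))

module _ {p : ℕ} .{{_ : NonZero p}} where

  reduce : ∀ z → ∃ λ (i : Fin p) → + p ∣ z - residue i
  reduce z = fromℕ< (n%ℕd<d z p) , divides (z /ℕ p) (begin
    z - + toℕ (fromℕ< (n%ℕd<d z p))            ≡⟨ cong (λ r → z - + r) (toℕ-fromℕ< (n%ℕd<d z p)) ⟩
    z - + (z %ℕ p)                             ≡⟨ cong (_- + (z %ℕ p)) (a≡a%ℕn+[a/ℕn]*n z p) ⟩
    + (z %ℕ p) + (z /ℕ p) * + p - + (z %ℕ p)   ≡⟨ step (+ (z %ℕ p)) ((z /ℕ p) * + p) ⟩
    (z /ℕ p) * + p                             ∎)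
    where
    open ≡-Reasoning
    step : ∀ r s → r + s - r ≡ s
    step = solve-∀

  module _ (pp : Prime p) where

    prime∣* : ∀ a b → + p ∣ a * b → + p ∣ a ⊎ + p ∣ b
    prime∣* a b p∣ab = Sum.map ∣ᵤ⇒∣ ∣ᵤ⇒∣
      (euclidsLemma ℤ.∣ a ∣ ℤ.∣ b ∣ pp (subst (p ℕ.∣_) (abs-* a b) (∣⇒∣ᵤ p∣ab)))

    -- The remainder `r` of `k` is nonzero and below the prime `p`, hence coprime to it, and a
    -- Bézout identity yields the inverse.
    inverse : ∀ k → ¬ (+ p ∣ k) → ∃ λ u → + p ∣ u * k - 1ℤ
    inverse k p∤k with k %ℕ p | n%ℕd<d k p | a≡a%ℕn+[a/ℕn]*n k p
    ... | ℕ.zero      | _   | k≡ = contradiction (divides (k /ℕ p) (trans k≡ (+-identityˡ _))) p∤k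
    ... | r@(ℕ.suc _) | r<p | k≡ with coprime-Bézout (prime⇒coprime pp r<p)
    -- Here `1 + y * r` equals `x * p`, so `y * r` is -1 modulo `p` and the sign of `y` must be
    -- flipped.
    ... | Bézout.+- x y eq = - + y , divides (- + x - + y * (k /ℕ p)) (begin
      - + y * k - 1ℤ                              ≡⟨ cong (λ z → - + y * z - 1ℤ) k≡ ⟩
      - + y * (+ r + q * + p) - 1ℤ                ≡⟨ step₁ (+ y) (+ r) q (+ p) ⟩
      - (1ℤ + + y * + r) - + y * q * + p          ≡⟨ cong (λ z → - z - + y * q * + p) eqℤ ⟩
      - (+ x * + p) - + y * q * + p               ≡⟨ step₂ (+ x) (+ y) q (+ p) ⟩
      (- + x - + y * q) * + p                     ∎)
      where
      open ≡-Reasoning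
      q = k /ℕ p
      eqℤ : 1ℤ + + y * + r ≡ + x * + p
      eqℤ = trans (cong (λ z → 1ℤ + z) (sym (pos-* y r))) (trans (cong +_ eq) (pos-* x p))
      step₁ : ∀ y r q p → - y * (r + q * p) - 1ℤ ≡ - (1ℤ + y * r) - y * q * p
      step₁ = solve-∀
      step₂ : ∀ x y q p → - (x * p) - y * q * p ≡ (- x - y * q) * p
      step₂ = solve-∀
    -- Here `y * r` equals `1 + x * p`, so `y` itself is the inverse.
    ... | Bézout.-+ x y eq = + y , divides (+ x + + y * (k /ℕ p)) (begin
      + y * k - 1ℤ                                ≡⟨ cong (λ z → + y * z - 1ℤ) k≡ ⟩
      + y * (+ r + q * + p) - 1ℤ                  ≡⟨ step₁ (+ y) (+ r) q (+ p) ⟩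
      + y * + r + + y * q * + p - 1ℤ              ≡⟨ cong (λ z → z + + y * q * + p - 1ℤ) eqℤ ⟨
      1ℤ + + x * + p + + y * q * + p - 1ℤ         ≡⟨ step₂ (+ x) (+ y) q (+ p) ⟩
      (+ x + + y * q) * + p                       ∎)
      where
      open ≡-Reasoning
      q = k /ℕ p
      eqℤ : 1ℤ + + x * + p ≡ + y * + r
      eqℤ = trans (cong (λ z → 1ℤ + z) (sym (pos-* x p))) (trans (cong +_ eq) (pos-* y r))
      step₁ : ∀ y r q p → y * (r + q * p) - 1ℤ ≡ y * r + y * q * p - 1ℤ
      step₁ = solve-∀
      step₂ : ∀ x y q p → 1ℤ + x * p + y * q * p - 1ℤ ≡ (x + y * q) * p
      step₂ = solve-∀

    -- The solution is the residue of `u * c`, with `u` inverse to `k`. Two solutions differ by a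
    -- residue difference that `k` multiplies into a multiple of `p`, and Euclid's lemma cancels
    -- `k`.
    linear-∃! : ∀ c k → ¬ (+ p ∣ k) → ∃! _≡_ λ (i : Fin p) → + p ∣ c - k * residue i
    linear-∃! c k p∤k with inverse k p∤k
    ... | u , p∣uk-1 with reduce (u * c)
    ... | i , p∣uc-i = i , solves , unique
      where
      witness : ∀ c k u i → k * (u * c - i) - c * (u * k - 1ℤ) ≡ c - k * i
      witness = solve-∀
      difference : ∀ c k i j → (c - k * j) - (c - k * i) ≡ k * (i - j)
      difference = solve-∀

      solves : + p ∣ c - k * residue i
      solves = subst (+ p ∣_) (witness c k u (residue i))
        (∣m∣n⇒∣m-n (∣n⇒∣m*n k p∣uc-i) (∣n⇒∣m*n c p∣uk-1))

      unique : ∀ {j} → + p ∣ c - k * residue j → i ≡ j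
      unique {j} p∣c-kj =
        [ (λ p∣k → contradiction p∣k p∤k) , residue-injective ]′
          (prime∣* k (residue i - residue j)
            (subst (+ p ∣_) (difference c k (residue i) (residue j)) (∣m∣n⇒∣m-n p∣c-kj solves)))

    -- Points of the family above a fixed x.

    module _ (m n : ℤ) where

      E-∃!t : ¬ (+ p ∣ n) → ∀ x y → ¬ (+ p ∣ residue x) →
              ∃! _≡_ λ t → OnCurve (E m n) p (residue t) (x , y)
      E-∃!t p∤n x y p∤x =
        ∃!-map
          (λ {t} → subst (+ p ∣_) (sym (linear (Y ^ 2) G n (residue t) X)))
          (λ {t} → subst (+ p ∣_) (linear (Y ^ 2) G n (residue t) X))
          -- By Euclid's lemma, `p` dividing `n * X` would divide `n` or `X`.
          (linear-∃! (Y ^ 2 - G) (n * X)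
            ([ p∤n , p∤x ]′ ∘ prime∣* n X))
        where
        X = residue x
        Y = residue y
        G = + 4 * X ^ 3 + (+ 4 * m + + 1) * X ^ 2

        linear : ∀ y² g n t x → y² - (g + n * t * x) ≡ y² - g - n * x * t
        linear = solve-∀

      -- The only solution is y = 0, represented here by y = x, as p ∣ x.
      E-∃!y : ∀ t x → + p ∣ residue x → ∃! _≡_ λ y → OnCurve (E m n) p t (x , y)
      E-∃!y t x p∣x = x , solves , unique
        where
        X = residue x

        g = + 4 * X ^ 2 + (+ 4 * m + + 1) * X ^ 1 + n * t

        -- The powers of `X` are unfolded down to `X ^ 1`, which enters as the atom `x¹`, so that
        -- the left side agrees with `E` by computation.
        factor : ∀ y² c d e x x¹ →
                 y² - (c * (x * (x * x¹)) + d * (x * x¹) + e * x) ≡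
                 y² - x * (c * (x * x¹) + d * x¹ + e)
        factor = solve-∀

        f≡Xg : ∀ y² → y² - E m n t X ≡ y² - X * g
        f≡Xg y² = factor y² (+ 4) (+ 4 * m + + 1) (n * t) X (X ^ 1)

        p∣Xg : + p ∣ X * g
        p∣Xg = ∣m⇒∣m*n g p∣x

        solves : OnCurve (E m n) p t (x , x)
        solves = subst (+ p ∣_) (sym (f≡Xg (X ^ 2))) (∣m∣n⇒∣m-n (∣m⇒∣m*n (X ^ 1) p∣x) p∣Xg)

        unique : ∀ {y} → OnCurve (E m n) p t (x , y) → x ≡ y
        unique {y} on = residue-injective (∣m∣n⇒∣m-n p∣x p∣Y)
          where
          Y = residue y
          p∣Y² : + p ∣ Y ^ 2
          -- Adding back `X * g`, a multiple of `p`, isolates `Y ^ 2`.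
          p∣Y² = subst (+ p ∣_) (i-j+j≡i (Y ^ 2) (X * g))
            (∣m∣n⇒∣m+n (subst (+ p ∣_) (f≡Xg (Y ^ 2)) on) p∣Xg)
          p∣Y : + p ∣ Y
          p∣Y = [ id , subst (+ p ∣_) (*-identityʳ Y) ]′ (prime∣* Y (Y ^ 1) p∣Y²)

      onE : Fin p → Fin p → Fin p → ℤ
      onE t x y = 𝟙 (onCurve? (E m n) p (residue t) (x , y))

      E-points-over-x : ¬ (+ p ∣ n) → ∀ x → ∑[ t < p ] ∑[ y < p ] onE t x y ≡ + p
      E-points-over-x p∤n x = case (+ p ∣? residue x)
        where
        case : Dec (+ p ∣ residue x) → ∑[ t < p ] ∑[ y < p ] onE t x y ≡ + p
        case (yes p∣x) = ∑-ones λ t →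
          ∑-𝟙-unique (λ y → onCurve? (E m n) p (residue t) (x , y)) (E-∃!y (residue t) x p∣x)
        -- Uniqueness now holds in `t` for fixed `y`, so `t` has to become the inner variable.
        case (no p∤x)  = trans (∑-comm λ t y → onE t x y) (∑-ones λ y →
          ∑-𝟙-unique (λ t → onCurve? (E m n) p (residue t) (x , y)) (E-∃!t p∤n x y p∤x))

      ∑-#points-E : ¬ (+ p ∣ n) → ∑[ t < p ] (+ #points (E m n) p (residue t)) ≡ + p * + p
      ∑-#points-E p∤n = begin
        ∑[ t < p ] (+ #points (E m n) p (residue t))   ≡⟨ sum-cong-≗ {p} (λ t → #points-∑ (E m n) p (residue t)) ⟩
        -- A single fibre over `t` has no evident point count; moving `x` outermost gives the
        -- constant count `p`.
        ∑[ t < p ] ∑[ x < p ] ∑[ y < p ] onE t x y     ≡⟨ ∑-comm (λ t x → ∑[ y < p ] onE t x y) ⟩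
        ∑[ x < p ] ∑[ t < p ] ∑[ y < p ] onE t x y     ≡⟨ sum-cong-≗ (E-points-over-x p∤n) ⟩
        ∑[ x < p ] (+ p)                               ≡⟨ ∑-const p (+ p) ⟩
        + p * + p                                      ∎
        where open ≡-Reasoning

lemma2p4 : (p : ℕ) .{{_ : NonZero p}} → Prime p → p ≢ 2 →
    (m n : ℤ) → ¬ (+ p ∣ n) → A₁ (E m n) p ≡ 0ℚ
lemma2p4 p pp _ m n p∤n = trans (cong (_/ p) ∑a≡0) (0/n≡0 p)
  where
  open ≡-Reasoning
  ∑a≡0 : ∑[ t < p ] a (E m n) (residue t) p ≡ 0ℤ
  ∑a≡0 = begin
    ∑[ t < p ] a (E m n) (residue t) p                          ≡⟨ ∑-minus p (+ p) (λ t → + #points (E m n) p (residue t)) ⟩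
    + p * + p - ∑[ t < p ] (+ #points (E m n) p (residue t))    ≡⟨ cong (λ s → + p * + p - s) (∑-#points-E pp m n p∤n) ⟩
    + p * + p - + p * + p                                       ≡⟨ +-inverseʳ (+ p * + p) ⟩
    0ℤ                                                          ∎
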